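{- For every integer $n\geq 9$ with $n\equiv 2 \pmod 7$, there exists a simple plane graph $G$ on $n$ vertices containing neither $K_4$ nor $C_5$ as a subgraph such that $e(G)=\frac{15}{7}(n-2)$.
   Context: $K_4$ is the complete graph on $4$ vertices, $C_5$ the cycle on $5$ vertices; $e(G)$ is the number of edges of $G$. -}

module Defs where

open import Data.Bool using (Bool; false; not; _∨_; T)
open import Data.Bool.Properties using (∨-comm)
open import Data.Empty using (⊥-elim)
open import Data.Fin using (Fin; zero; suc; toℕ; _<_)
open import Data.Fin.Properties using (_≟_; _<?_)
open import Data.List using (length; filter; allFin; cartesianProduct)
import Data.Nat as ℕ
open import Data.Nat using (ℕ)
open import Data.Nat.DivMod using (_%_)
open import Data.Product using (_×_; _,_; proj₁; proj₂; Σ; ∃-syntax)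
open import Data.Rational using (ℚ; 0ℚ; 1ℚ; _+_; _-_; _*_; _≤_)
open import Data.Sum using (_⊎_)
open import Function.Definitions using (Injective)
open import Relation.Binary.PropositionalEquality using (_≡_; _≢_; refl; sym)
open import Relation.Nullary using (yes; no)
open import Relation.Nullary.Decidable using (⌊_⌋; T?; _×-dec_)

record SimpleGraph (n : ℕ) : Set where
  field
    adj        : Fin n → Fin n → Bool
    adj-sym    : ∀ u v → adj u v ≡ adj v u
    adj-irrefl : ∀ v → adj v v ≡ false

  _~_ : Fin n → Fin n → Set
  u ~ v = T (adj u v)

open SimpleGraph using (adj)

-- Each undirected edge {u , v} is represented once, by its ordered pair
-- with u < v.
record Edge {n : ℕ} (G : SimpleGraph n) : Set where
  open SimpleGraph G using (_~_)
  field
    src tgt  : Fin n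
    src<tgt  : src < tgt
    adjacent : src ~ tgt

e : ∀ {n} → SimpleGraph n → ℕ
e {n} G = length (filter (λ p → (proj₁ p <? proj₂ p) ×-dec T? (adj G (proj₁ p) (proj₂ p)))
                         (cartesianProduct (allFin n) (allFin n)))

-- Subgraph containment is not necessarily induced: edges of H must be
-- preserved, non-edges need not be.
_⊑_ : ∀ {m n} → SimpleGraph m → SimpleGraph n → Set
_⊑_ {m} {n} H G =
  Σ (Fin m → Fin n) λ f →
    Injective _≡_ _≡_ f × (∀ i j → SimpleGraph._~_ H i j → SimpleGraph._~_ G (f i) (f j))

K : (m : ℕ) → SimpleGraph m
K m = record
  { adj        = λ i j → not ⌊ i ≟ j ⌋
  ; adj-sym    = symm
  ; adj-irrefl = irr
  }
  where
  symm : ∀ (i j : Fin m) → not ⌊ i ≟ j ⌋ ≡ not ⌊ j ≟ i ⌋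
  symm i j with i ≟ j | j ≟ i
  ... | yes _ | yes _ = refl
  ... | no _  | no _  = refl
  ... | yes p | no ¬q = ⊥-elim (¬q (sym p))
  ... | no ¬p | yes q = ⊥-elim (¬p (sym q))

  irr : ∀ (i : Fin m) → not ⌊ i ≟ i ⌋ ≡ false
  irr i with i ≟ i
  ... | yes _ = refl
  ... | no ¬p = ⊥-elim (¬p refl)

C₅ : SimpleGraph 5
C₅ = record
  { adj        = λ i j → next i j ∨ next j i
  ; adj-sym    = λ i j → ∨-comm (next i j) (next j i)
  ; adj-irrefl = λ { zero                         → refl
                   ; (suc zero)                   → refl
                   ; (suc (suc zero))             → refl
                   ; (suc (suc (suc zero)))       → refl
                   ; (suc (suc (suc (suc zero)))) → refl
                   }
  }
  where
  next : Fin 5 → Fin 5 → Bool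
  next i j = ⌊ ℕ.suc (toℕ i) % 5 ℕ.≟ toℕ j ⌋

-- Plane graphs are drawn with polygonal arcs as edges (as in Diestel's
-- textbook definition), all of whose corners have rational coordinates.
-- Two segments with rational endpoints that meet in ℝ² also meet in a point
-- of ℚ², and if they meet in ℝ² in more than one point they also do so in
-- ℚ².  Hence the disjointness conditions below, although they only quantify
-- over points of ℚ², are equivalent to the same conditions over ℝ².
Point : Set
Point = ℚ × ℚ

OnSegment : Point → Point → Point → Set
OnSegment (px , py) (qx , qy) (x , y) =
  ∃[ t ] 0ℚ ≤ t × t ≤ 1ℚ × x ≡ px + t * (qx - px) × y ≡ py + t * (qy - py)

data Polyline : Point → Point → Set where
  segment : ∀ p q → Polyline p q
  _∷_     : ∀ p {b q} → Polyline b q → Polyline p q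

infixr 5 _∷_

_∈_ : ∀ {p q} → Point → Polyline p q → Set
x ∈ segment p q   = OnSegment p q x
x ∈ (_∷_ p {b} l) = OnSegment p b x ⊎ x ∈ l

-- The polyline does not touch itself, i.e. it is homeomorphic to [0,1].
IsArc : ∀ {p q} → Polyline p q → Set
IsArc (segment p q)   = p ≢ q
IsArc (_∷_ p {b} l)   = p ≢ b × (∀ x → OnSegment p b x → x ∈ l → x ≡ b) × IsArc l

record PlaneGraph (n : ℕ) : Set where
  field
    graph         : SimpleGraph n
    pos           : Fin n → Point
    pos-injective : Injective _≡_ _≡_ pos

  open Edge

  field
    arc       : (a : Edge graph) → Polyline (pos (src a)) (pos (tgt a))
    arc-isArc : ∀ a → IsArc (arc a)
    -- The interior of an edge contains no vertex ...
    no-vertex : ∀ a w → pos w ∈ arc a → w ≡ src a ⊎ w ≡ tgt a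
    -- ... and no point of any other edge.
    no-cross  : ∀ a b → a ≢ b → ∀ x → x ∈ arc a → x ∈ arc b →
                x ≡ pos (src a) ⊎ x ≡ pos (tgt a)

open PlaneGraph public using (graph)

{-# OPTIONS --safe #-}
module Submission where

-- Three copies of K₄ minus an edge, joined in a ring at their vertices of degree two,
-- form a plane graph with 9 vertices and 15 edges whose faces are six triangles and two
-- hexagons. Take two opposite vertices ("poles", at distance 3) of the outer hexagon and
-- glue k copies of this gadget along the poles: the result has 2 + 7k vertices and 15k
-- edges. A cycle that meets two copies passes through both poles, so it has length at
-- least 6, and the gadget itself contains neither K₄ nor C₅.
--
-- For the drawing, the gadget is placed in the strip 10 − |x| ≤ y ≤ 2 (10 − |x|), with
-- the poles at (±10 , 0), and the i-th copy is obtained by multiplying y by 4 ^ i. The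
-- images of the strip then meet only at the poles, so crossings need to be excluded
-- only inside the gadget, where this is a finite computation.

open import Algebra.Properties.CommutativeMonoid.Sum as MonoidSum using ()
open import Data.Bool as Bool using (Bool; true; false; T; _∧_; if_then_else_)
open import Data.Bool.Properties using (T-∧; T-irrelevant; ∧-zeroʳ)
open import Data.Fin as Fin using (Fin; zero; suc; toℕ; combine; remQuot; _↑ˡ_; _↑ʳ_)
open import Data.Fin.Patterns using (0F; 1F; 2F; 3F; 4F; 5F; 6F; 7F; 8F)
open import Data.Fin.Properties as Finₚ using (all?; _≟_; _<?_; remQuot-combine; combine-remQuot; toℕ-combine)
open import Data.Integer as ℤ using (+_; -[1+_])
import Data.Integer.Properties as ℤ
open import Data.List using (List; []; _∷_; _++_; length; filter; map; tabulate; cartesianProduct)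
open import Data.List.Membership.DecPropositional {A = Fin 9} _≟_ using (_∈?_)
open import Data.List.Properties using (length-++; filter-++)
open import Data.Nat as ℕ using (ℕ; _≥_)
open import Data.Nat.DivMod using (_%_; m≡m%n+[m/n]*n) renaming (_/_ to _div_)
import Data.Nat.Properties as ℕ
open import Data.Product using (Σ; _×_; _,_; proj₁; proj₂; ∃-syntax; uncurry)
open import Data.Product.Properties using (≡-dec)
open import Data.Rational using (ℚ; 0ℚ; 1ℚ; _+_; _-_; -_; _*_; _≤_; _<_; _/_; ∣_∣; 1/_; toℚᵘ; Positive; nonNegative; ≢-nonZero)
open import Data.Rational.Properties as ℚ using (*-identityʳ; *-inverseʳ; *-assoc; *-comm; *-zeroˡ; *-zeroʳ; *-monoˡ-≤-nonNeg; *-monoʳ-≤-nonNeg; *-cancelˡ-≤-pos; +-identityˡ; +-identityʳ; +-inverseʳ; +-mono-≤; +-monoˡ-≤; +-monoʳ-≤; neg-antimono-≤; ≤-refl; ≤-reflexive; ≤-antisym; ≤-trans; ≤-total; ≤ᵇ⇒≤; <⇒≤; <-irrefl; nonNegative⁻¹; nonNeg*nonNeg⇒nonNeg; pos⇒nonNeg; pos+pos⇒pos; pos*pos⇒pos; 0≤p⇒∣p∣≡p; ∣-p∣≡∣p∣; module ≤-Reasoning)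
open import Data.Rational.Solver using (module +-*-Solver)
import Data.Rational.Unnormalised as ℚᵘ
import Data.Rational.Unnormalised.Properties as ℚᵘ
open import Data.Sum as Sum using (_⊎_; inj₁; inj₂; [_,_]′)
open import Function using (_∘_; id)
open import Function.Bundles using (Equivalence; mk⇔)
open import Level using (0ℓ)
open import Relation.Binary.Definitions using (tri<; tri≈; tri>)
open import Relation.Binary.PropositionalEquality using (_≡_; _≢_; refl; sym; trans; cong; cong₂; subst; subst₂; module ≡-Reasoning)
open import Relation.Nullary using (Dec; does; yes; no; ¬_; contradiction)
open import Relation.Nullary.Decidable using (T?; ¬?; _×-dec_; _⊎-dec_; _→-dec_; toWitness; does-⇔)
open import Relation.Unary using (Pred; Decidable)
open import Defs using (SimpleGraph; Edge; Point; OnSegment; segment; PlaneGraph; graph; K; C₅; _⊑_; e)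

open +-*-Solver using (solve; _:=_; _:+_; _:-_; _:*_; con) renaming (:-_ to ⊝_)
open MonoidSum ℕ.+-0-commutativeMonoid using (sum; sum-cong-≗; sum-replicate-zero)

-- Segments and affine functions

*-nonNeg : ∀ {a b} → 0ℚ ≤ a → 0ℚ ≤ b → 0ℚ ≤ a * b
*-nonNeg {a} {b} 0≤a 0≤b =
  nonNegative⁻¹ (a * b) {{nonNeg*nonNeg⇒nonNeg a {{nonNegative 0≤a}} b {{nonNegative 0≤b}}}}

*≡0⇒≡0 : ∀ {a b} → b ≢ 0ℚ → a * b ≡ 0ℚ → a ≡ 0ℚ
*≡0⇒≡0 {a} {b} b≢0 ab≡0 = begin
  a               ≡⟨ *-identityʳ a ⟨
  a * 1ℚ          ≡⟨ cong (a *_) (*-inverseʳ b) ⟨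
  a * (b * 1/ b)  ≡⟨ *-assoc a b (1/ b) ⟨
  a * b * 1/ b    ≡⟨ cong (_* 1/ b) ab≡0 ⟩
  0ℚ * 1/ b       ≡⟨ *-zeroˡ (1/ b) ⟩
  0ℚ              ∎
  where
  open ≡-Reasoning
  instance _ = ≢-nonZero b≢0

p≤q⇒0≤q-p : ∀ {a b} → a ≤ b → 0ℚ ≤ b - a
p≤q⇒0≤q-p {a} {b} a≤b = subst (_≤ b - a) (+-inverseʳ a) (+-monoˡ-≤ (- a) a≤b)

0≤q-p⇒p≤q : ∀ {a b} → 0ℚ ≤ b - a → a ≤ b
0≤q-p⇒p≤q {a} {b} h = subst₂ _≤_ (+-identityʳ a)
  (solve 2 (λ a b → a :+ (b :- a) := b) refl a b) (+-monoʳ-≤ a h)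

+≡0⇒≡0 : ∀ {a b} → 0ℚ ≤ a → 0ℚ ≤ b → a + b ≡ 0ℚ → b ≡ 0ℚ
+≡0⇒≡0 {a} {b} 0≤a 0≤b a+b≡0 =
  ≤-antisym (subst₂ _≤_ (+-identityˡ b) a+b≡0 (+-monoˡ-≤ b 0≤a)) 0≤b

0≤square : ∀ a → 0ℚ ≤ a * a
0≤square a with ≤-total 0ℚ a
... | inj₁ 0≤a = *-nonNeg 0≤a 0≤a
... | inj₂ a≤0 = subst (0ℚ ≤_) (solve 1 (λ a → (⊝ a) :* (⊝ a) := a :* a) refl a)
                   (*-nonNeg (neg-antimono-≤ a≤0) (neg-antimono-≤ a≤0))

mix : ℚ → ℚ → ℚ → ℚ
mix t a b = a + t * (b - a)

mix-as-sum : ∀ t a b → mix t a b ≡ (1ℚ - t) * a + t * b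
mix-as-sum = solve 3 (λ t a b → a :+ t :* (b :- a) := (con 1ℚ :- t) :* a :+ t :* b) refl

mix-swap : ∀ t a b → mix t a b ≡ mix (1ℚ - t) b a
mix-swap = solve 3 (λ t a b →
  a :+ t :* (b :- a) := b :+ (con 1ℚ :- t) :* (a :- b)) refl

mix-0 : ∀ a b → mix 0ℚ a b ≡ a
mix-0 = solve 2 (λ a b → a :+ con 0ℚ :* (b :- a) := a) refl

mix-1 : ∀ a b → mix 1ℚ a b ≡ b
mix-1 = solve 2 (λ a b → a :+ con 1ℚ :* (b :- a) := b) refl

mix-nonNeg : ∀ {t a b} → 0ℚ ≤ t → t ≤ 1ℚ → 0ℚ ≤ a → 0ℚ ≤ b → 0ℚ ≤ mix t a b
mix-nonNeg {t} {a} {b} 0≤t t≤1 0≤a 0≤b = subst (0ℚ ≤_) (sym (mix-as-sum t a b))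
  (+-mono-≤ (*-nonNeg (p≤q⇒0≤q-p t≤1) 0≤a) (*-nonNeg 0≤t 0≤b))

mix-mono-≤ : ∀ {t a b c d} → 0ℚ ≤ t → t ≤ 1ℚ → a ≤ c → b ≤ d → mix t a b ≤ mix t c d
mix-mono-≤ {t} {a} {b} {c} {d} 0≤t t≤1 a≤c b≤d = 0≤q-p⇒p≤q
  (subst (0ℚ ≤_)
    (solve 5 (λ t a b c d → (c :- a) :+ t :* ((d :- b) :- (c :- a))
                         := (c :+ t :* (d :- c)) :- (a :+ t :* (b :- a))) refl t a b c d)
    (mix-nonNeg 0≤t t≤1 (p≤q⇒0≤q-p a≤c) (p≤q⇒0≤q-p b≤d)))

-- Multiplying by `b` turns the equation into `(1 - t)ab + tb² = 0`, a sum of two non-negative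
-- terms, so `tb²` vanishes and `b` can be cancelled twice.
mix≡0⇒t≡0 : ∀ {t a b} → 0ℚ ≤ t → t ≤ 1ℚ → 0ℚ ≤ a * b → b ≢ 0ℚ → mix t a b ≡ 0ℚ → t ≡ 0ℚ
mix≡0⇒t≡0 {t} {a} {b} 0≤t t≤1 0≤ab b≢0 m≡0 =
  *≡0⇒≡0 b≢0 (*≡0⇒≡0 {t * b} b≢0 (trans (*-assoc t b b)
    (+≡0⇒≡0 (*-nonNeg (p≤q⇒0≤q-p t≤1) 0≤ab) (*-nonNeg 0≤t (0≤square b))
      (trans (solve 3 (λ t a b → (con 1ℚ :- t) :* (a :* b) :+ t :* (b :* b)
                              := (a :+ t :* (b :- a)) :* b) refl t a b)
        (trans (cong (_* b) m≡0) (*-zeroˡ b))))))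

-- The previous case read on the reversed segment, with parameter `1 - t`.
mix≡0⇒t≡1 : ∀ {t a b} → 0ℚ ≤ t → t ≤ 1ℚ → 0ℚ ≤ a * b → a ≢ 0ℚ → mix t a b ≡ 0ℚ → t ≡ 1ℚ
mix≡0⇒t≡1 {t} {a} {b} 0≤t t≤1 0≤ab a≢0 m≡0 = begin
  t              ≡⟨ solve 1 (λ t → t := con 1ℚ :- (con 1ℚ :- t)) refl t ⟩
  1ℚ - (1ℚ - t)  ≡⟨ cong (λ u → 1ℚ - u) 1-t≡0 ⟩
  1ℚ             ∎
  where
  open ≡-Reasoning
  1-t≡0 : 1ℚ - t ≡ 0ℚ
  1-t≡0 = mix≡0⇒t≡0 {1ℚ - t} {b} {a} (p≤q⇒0≤q-p t≤1)
    (0≤q-p⇒p≤q (subst (0ℚ ≤_) (solve 1 (λ t → t := con 1ℚ :- (con 1ℚ :- t)) refl t) 0≤t))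
    (subst (0ℚ ≤_) (*-comm a b) 0≤ab) a≢0 (trans (sym (mix-swap t a b)) m≡0)

SameSign : ℚ → ℚ → Set
SameSign a b = (0ℚ ≤ a × 0ℚ ≤ b) ⊎ (a ≤ 0ℚ × b ≤ 0ℚ)

∣mix∣ : ∀ {t a b} → 0ℚ ≤ t → t ≤ 1ℚ → SameSign a b → ∣ mix t a b ∣ ≡ mix t (∣ a ∣) (∣ b ∣)
∣mix∣ {t} 0≤t t≤1 (inj₁ (0≤a , 0≤b)) = trans (0≤p⇒∣p∣≡p (mix-nonNeg 0≤t t≤1 0≤a 0≤b))
  (sym (cong₂ (mix t) (0≤p⇒∣p∣≡p 0≤a) (0≤p⇒∣p∣≡p 0≤b)))
∣mix∣ {t} {a} {b} 0≤t t≤1 (inj₂ (a≤0 , b≤0)) = begin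
  ∣ mix t a b ∣              ≡⟨ ∣-p∣≡∣p∣ (mix t a b) ⟨
  ∣ - mix t a b ∣            ≡⟨ cong ∣_∣ (solve 3 (λ t a b →
                                 ⊝ (a :+ t :* (b :- a)) := (⊝ a) :+ t :* ((⊝ b) :- (⊝ a))) refl t a b) ⟩
  ∣ mix t (- a) (- b) ∣      ≡⟨ ∣mix∣ {t} { - a} { - b} 0≤t t≤1 (inj₁ (neg-antimono-≤ a≤0 , neg-antimono-≤ b≤0)) ⟩
  mix t (∣ - a ∣) (∣ - b ∣)  ≡⟨ cong₂ (mix t) (∣-p∣≡∣p∣ a) (∣-p∣≡∣p∣ b) ⟩
  mix t (∣ a ∣) (∣ b ∣)      ∎
  where open ≡-Reasoning

AffineOn : Point → Point → (Point → ℚ) → Set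
AffineOn (px , py) (qx , qy) L = ∀ t → 0ℚ ≤ t → t ≤ 1ℚ →
  L (mix t px qx , mix t py qy) ≡ mix t (L (px , py)) (L (qx , qy))

-- The source of all disjointness results below, with `L` either a signed area or `tent`. Weakly
-- equal signs at the ends pin the parameter of a zero to 0 if `L q` is nonzero, and to 1 if `L p`
-- is.
zero⇒endpoint : ∀ p q z (L : Point → ℚ) → AffineOn p q L → 0ℚ ≤ L p * L q → L p ≢ 0ℚ ⊎ L q ≢ 0ℚ →
                OnSegment p q z → L z ≡ 0ℚ → z ≡ p ⊎ z ≡ q
zero⇒endpoint (px , py) (qx , qy) _ L affine 0≤LpLq (inj₂ Lq≢0) (t , 0≤t , t≤1 , refl , refl) Lz≡0 =
  inj₁ (trans (cong (λ t → mix t px qx , mix t py qy) t≡0) (cong₂ _,_ (mix-0 px qx) (mix-0 py qy)))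
  where
  t≡0 : t ≡ 0ℚ
  t≡0 = mix≡0⇒t≡0 {t} {L (px , py)} {L (qx , qy)} 0≤t t≤1 0≤LpLq Lq≢0
          (trans (sym (affine t 0≤t t≤1)) Lz≡0)
zero⇒endpoint (px , py) (qx , qy) _ L affine 0≤LpLq (inj₁ Lp≢0) (t , 0≤t , t≤1 , refl , refl) Lz≡0 =
  inj₂ (trans (cong (λ t → mix t px qx , mix t py qy) t≡1) (cong₂ _,_ (mix-1 px qx) (mix-1 py qy)))
  where
  t≡1 : t ≡ 1ℚ
  t≡1 = mix≡0⇒t≡1 {t} {L (px , py)} {L (qx , qy)} 0≤t t≤1 0≤LpLq Lp≢0
          (trans (sym (affine t 0≤t t≤1)) Lz≡0)

-- Twice the signed area of the triangle p q z.
side : Point → Point → Point → ℚ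
side (px , py) (qx , qy) (x , y) = (qx - px) * (y - py) - (qy - py) * (x - px)

side-affine : ∀ r s p q → AffineOn p q (side r s)
side-affine (rx , ry) (sx , sy) (px , py) (qx , qy) t _ _ =
  solve 9 (λ rx ry sx sy px py qx qy t →
    (sx :- rx) :* ((py :+ t :* (qy :- py)) :- ry) :- (sy :- ry) :* ((px :+ t :* (qx :- px)) :- rx)
    := ((sx :- rx) :* (py :- ry) :- (sy :- ry) :* (px :- rx))
       :+ t :* (((sx :- rx) :* (qy :- ry) :- (sy :- ry) :* (qx :- rx))
                :- ((sx :- rx) :* (py :- ry) :- (sy :- ry) :* (px :- rx))))
    refl rx ry sx sy px py qx qy t

OnSegment⇒side≡0 : ∀ p q z → OnSegment p q z → side p q z ≡ 0ℚ
OnSegment⇒side≡0 (px , py) (qx , qy) _ (t , _ , _ , refl , refl) =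
  solve 5 (λ px py qx qy t →
    (qx :- px) :* ((py :+ t :* (qy :- py)) :- py) :- (qy :- py) :* ((px :+ t :* (qx :- px)) :- px)
    := con 0ℚ) refl px py qx qy t

-- Either p and q lie on the same closed side of the line r s, not both on the
-- line, or r and s lie strictly on the same side of the line p q.
Apart : (p q r s : Point) → Set
Apart p q r s =
  (0ℚ ≤ side r s p * side r s q × (side r s p ≢ 0ℚ ⊎ side r s q ≢ 0ℚ)) ⊎
  (0ℚ < side p q r * side p q s)

-- A common point is a zero of both side functions. In the first case the one of `r s` forces it to
-- an end of `p q`; in the second the one of `p q` would force it to `r` or `s`, where that function
-- is nonzero.
apart⇒endpoint : ∀ p q r s z → Apart p q r s → OnSegment p q z → OnSegment r s z → z ≡ p ⊎ z ≡ q
apart⇒endpoint p q r s z (inj₁ (0≤ , ≢0)) z∈pq z∈rs =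
  zero⇒endpoint p q z (side r s) (side-affine r s p q) 0≤ ≢0 z∈pq (OnSegment⇒side≡0 r s z z∈rs)
apart⇒endpoint p q r s z (inj₂ 0<ρσ) z∈pq z∈rs = contradiction z≡r⊎z≡s λ where
    (inj₁ z≡r) → ρ≢0 (trans (cong (side p q) (sym z≡r)) side-z≡0)
    (inj₂ z≡s) → σ≢0 (trans (cong (side p q) (sym z≡s)) side-z≡0)
  where
  ρ = side p q r
  σ = side p q s
  ρ≢0 : ρ ≢ 0ℚ
  ρ≢0 ρ≡0 = <-irrefl (sym (trans (cong (_* σ) ρ≡0) (*-zeroˡ σ))) 0<ρσ
  σ≢0 : σ ≢ 0ℚ
  σ≢0 σ≡0 = <-irrefl (sym (trans (cong (ρ *_) σ≡0) (*-zeroʳ ρ))) 0<ρσ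
  side-z≡0 : side p q z ≡ 0ℚ
  side-z≡0 = OnSegment⇒side≡0 p q z z∈pq
  z≡r⊎z≡s : z ≡ r ⊎ z ≡ s
  z≡r⊎z≡s = zero⇒endpoint r s z (side p q) (side-affine p q r s) (<⇒≤ 0<ρσ) (inj₁ ρ≢0) z∈rs side-z≡0

-- The strip and its vertical scalings

tent : Point → ℚ
tent (x , _) = + 10 / 1 - ∣ x ∣

InStrip : Point → Set
InStrip z = tent z ≤ proj₂ z × proj₂ z ≤ tent z + tent z

-- The only kink of `tent` is at `x = 0`, and a segment whose ends have abscissas of the same sign
-- does not pass across it.
tent-affine : ∀ p q → SameSign (proj₁ p) (proj₁ q) → AffineOn p q tent
tent-affine (px , _) (qx , _) same t 0≤t t≤1 = trans (cong (λ a → + 10 / 1 - a) (∣mix∣ {t} {px} {qx} 0≤t t≤1 same))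
  (solve 4 (λ c t a b → c :- (a :+ t :* (b :- a)) := (c :- a) :+ t :* ((c :- b) :- (c :- a)))
    refl (+ 10 / 1) t (∣ px ∣) (∣ qx ∣))

OnSegment⇒InStrip : ∀ p q z → SameSign (proj₁ p) (proj₁ q) → InStrip p → InStrip q →
                    OnSegment p q z → InStrip z
OnSegment⇒InStrip p q z same (p₁ , p₂) (q₁ , q₂) (t , 0≤t , t≤1 , refl , refl) =
  subst (_≤ proj₂ z) (sym tent-z) (mix-mono-≤ 0≤t t≤1 p₁ q₁) ,
  subst (proj₂ z ≤_) (trans double (sym (cong₂ _+_ tent-z tent-z))) (mix-mono-≤ 0≤t t≤1 p₂ q₂)
  where
  tent-z : tent z ≡ mix t (tent p) (tent q)
  tent-z = tent-affine p q same t 0≤t t≤1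
  double : mix t (tent p + tent p) (tent q + tent q) ≡ mix t (tent p) (tent q) + mix t (tent p) (tent q)
  double = solve 3 (λ t a b → (a :+ a) :+ t :* ((b :+ b) :- (a :+ a))
                          := (a :+ t :* (b :- a)) :+ (a :+ t :* (b :- a))) refl t (tent p) (tent q)

InStrip⇒0≤tent : ∀ z → InStrip z → 0ℚ ≤ tent z
InStrip⇒0≤tent z (tent≤y , y≤2tent) = subst₂ _≤_ (+-inverseʳ (tent z))
  (solve 1 (λ a → (a :+ a) :- a := a) refl (tent z))
  (+-monoˡ-≤ (- tent z) (≤-trans tent≤y y≤2tent))

scale : ℚ → Point → Point
scale s (x , y) = x , s * y

scale-injective : ∀ s {{_ : Positive s}} {z z′} → scale s z ≡ scale s z′ → z ≡ z′
scale-injective s eq = cong₂ _,_ (cong proj₁ eq)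
  (≤-antisym (*-cancelˡ-≤-pos s (≤-reflexive (cong proj₂ eq)))
             (*-cancelˡ-≤-pos s (≤-reflexive (sym (cong proj₂ eq)))))

-- Scaling is linear, so the preimage has the same parameter on the unscaled segment.
unscale : ∀ s p q z → OnSegment (scale s p) (scale s q) z →
          ∃[ z′ ] z ≡ scale s z′ × OnSegment p q z′
unscale s (px , py) (qx , qy) _ (t , 0≤t , t≤1 , refl , refl) =
  (mix t px qx , mix t py qy) ,
  cong (mix t px qx ,_)
    (solve 4 (λ s t a b → s :* a :+ t :* (s :* b :- s :* a) := s :* (a :+ t :* (b :- a))) refl s t py qy) ,
  (t , 0≤t , t≤1 , refl , refl)

-- The ratio 4 exceeds 2, the ratio of the upper to the lower boundary of the strip; this separates
-- successive images away from the poles.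
weight : ℕ → ℚ
weight ℕ.zero    = 1ℚ
weight (ℕ.suc i) = (+ 4 / 1) * weight i

weight-pos : ∀ i → Positive (weight i)
weight-pos ℕ.zero    = _
weight-pos (ℕ.suc i) = pos*pos⇒pos (+ 4 / 1) (weight i) {{weight-pos i}}

1≤weight : ∀ i → 1ℚ ≤ weight i
1≤weight ℕ.zero    = ≤-refl
1≤weight (ℕ.suc i) = ≤-trans (≤ᵇ⇒≤ _) (*-monoˡ-≤-nonNeg (+ 4 / 1) (1≤weight i))

weight-mono-≤ : ∀ {i j} → i ℕ.≤ j → weight i ≤ weight j
weight-mono-≤ {j = j} ℕ.z≤n = 1≤weight j
weight-mono-≤ (ℕ.s≤s i≤j)   = *-monoˡ-≤-nonNeg (+ 4 / 1) (weight-mono-≤ i≤j)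

-- Scaling keeps `x`, so both points have the same tent height `h`. With `w = weight i`, the bounds
-- give `4wh ≤ weight j * h ≤ 2wh`, which forces `h ≤ 0`.
strips-meet-< : ∀ {i j} z z′ → i ℕ.< j → InStrip z → InStrip z′ →
                scale (weight i) z ≡ scale (weight j) z′ → tent z ≡ 0ℚ
strips-meet-< {i} {j} z z′ i<j in-z in-z′ eq =
  ≤-antisym (*-cancelˡ-≤-pos (w + w) {{pos+pos⇒pos w w}} bound) (InStrip⇒0≤tent z in-z)
  where
  open ≤-Reasoning
  h = tent z
  w = weight i
  instance
    w-pos : Positive w
    w-pos = weight-pos i
  tent≡ : h ≡ tent z′
  tent≡ = cong (λ x → + 10 / 1 - ∣ x ∣) (cong proj₁ eq)
  -- `i < j` is `suc i ≤ j`, and `weight (suc i)` is `4w` by definition.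
  quadruple : (+ 4 / 1) * w * h ≤ w * (h + h)
  quadruple = begin
    (+ 4 / 1) * w * h       ≤⟨ *-monoʳ-≤-nonNeg h {{nonNegative (InStrip⇒0≤tent z in-z)}} (weight-mono-≤ i<j) ⟩
    weight j * h            ≤⟨ *-monoˡ-≤-nonNeg (weight j) {{pos⇒nonNeg (weight j) {{weight-pos j}}}}
                                 (subst (_≤ proj₂ z′) (sym tent≡) (proj₁ in-z′)) ⟩
    weight j * proj₂ z′     ≡⟨ cong proj₂ eq ⟨
    w * proj₂ z             ≤⟨ *-monoˡ-≤-nonNeg w {{pos⇒nonNeg w}} (proj₂ in-z) ⟩
    w * (h + h)             ∎
  bound : (w + w) * h ≤ (w + w) * 0ℚ
  bound = subst₂ _≤_
    (solve 2 (λ w h → con (+ 4 / 1) :* w :* h :- w :* (h :+ h) := (w :+ w) :* h) refl w h)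
    (solve 2 (λ w h → w :* (h :+ h) :- w :* (h :+ h) := (w :+ w) :* con 0ℚ) refl w h)
    (+-monoˡ-≤ (- (w * (h + h))) quadruple)

strips-meet : ∀ {i j} z z′ → i ≢ j → InStrip z → InStrip z′ →
              scale (weight i) z ≡ scale (weight j) z′ → tent z ≡ 0ℚ
strips-meet {i} {j} z z′ i≢j in-z in-z′ eq with ℕ.<-cmp i j
... | tri< i<j _ _ = strips-meet-< z z′ i<j in-z in-z′ eq
... | tri≈ _ i≡j _ = contradiction i≡j i≢j
... | tri> _ _ j<i = trans (cong (λ x → + 10 / 1 - ∣ x ∣) (cong proj₁ eq))
                       (strips-meet-< z′ z j<i in-z′ in-z (sym eq))

-- The gadget

-- Three copies of K₄ minus an edge, joined in a ring at 0, 6 and 7; the poles 0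
-- and 1 are opposite corners of the outer hexagon 0 2 6 1 7 4.
neighbours : Fin 9 → List (Fin 9)
neighbours 0F = 2F ∷ 3F ∷ 4F ∷ 5F ∷ []
neighbours 1F = 6F ∷ 7F ∷ 8F ∷ []
neighbours 2F = 0F ∷ 3F ∷ 6F ∷ []
neighbours 3F = 0F ∷ 2F ∷ 6F ∷ []
neighbours 4F = 0F ∷ 5F ∷ 7F ∷ []
neighbours 5F = 0F ∷ 4F ∷ 7F ∷ []
neighbours 6F = 1F ∷ 2F ∷ 3F ∷ 8F ∷ []
neighbours 7F = 1F ∷ 4F ∷ 5F ∷ 8F ∷ []
neighbours 8F = 1F ∷ 6F ∷ 7F ∷ []

adj₀ : Fin 9 → Fin 9 → Bool
adj₀ u v = does (v ∈? neighbours u)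

infix 4 _~₀_ _~₀?_
_~₀_ : Fin 9 → Fin 9 → Set
u ~₀ v = T (adj₀ u v)

_~₀?_ : ∀ u v → Dec (u ~₀ v)
u ~₀? v = T? (adj₀ u v)

adj₀-sym : ∀ u v → adj₀ u v ≡ adj₀ v u
adj₀-sym = toWitness {a? = all? λ u → all? λ v → adj₀ u v Bool.≟ adj₀ v u} _

adj₀-irrefl : ∀ u → adj₀ u u ≡ false
adj₀-irrefl = toWitness {a? = all? λ u → adj₀ u u Bool.≟ false} _

-- With the poles themselves non-adjacent, this puts them at distance at least 3; it is what
-- excludes 5-cycles through two copies.
poles-far-apart : ∀ u → 0F ~₀ u → ¬ (1F ~₀ u)
poles-far-apart = toWitness {a? = all? λ u → 0F ~₀? u →-dec ¬? (1F ~₀? u)} _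

-- Labels of a 5-cycle in the glued graph may repeat, so the check concerns closed walks.
-- Consecutive vertices differ by irreflexivity, hence a repetition is at distance two along the
-- walk. Adjacency hypotheses are interleaved with the quantifiers to prune the search.
closed-5-walk-folds : ∀ a b → a ~₀ b → ∀ c → b ~₀ c → ∀ d → c ~₀ d → ∀ e → d ~₀ e → e ~₀ a →
                      a ≡ c ⊎ b ≡ d ⊎ c ≡ e ⊎ d ≡ a ⊎ e ≡ b
closed-5-walk-folds = toWitness {a? =
  all? λ a → all? λ b → a ~₀? b →-dec all? λ c → b ~₀? c →-dec all? λ d → c ~₀? d →-dec
  all? λ e → d ~₀? e →-dec e ~₀? a →-dec
    (a ≟ c ⊎-dec b ≟ d ⊎-dec c ≟ e ⊎-dec d ≟ a ⊎-dec e ≟ b)} _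

no-K₄ : ∀ a b → a ~₀ b → ∀ c → a ~₀ c → b ~₀ c → ∀ d → a ~₀ d → b ~₀ d → ¬ (c ~₀ d)
no-K₄ = toWitness {a? =
  all? λ a → all? λ b → a ~₀? b →-dec all? λ c → a ~₀? c →-dec b ~₀? c →-dec
  all? λ d → a ~₀? d →-dec b ~₀? d →-dec ¬? (c ~₀? d)} _

-- Straight-line drawing of the gadget

coord : Fin 9 → Point
coord 0F = -[1+ 9 ] / 1 , + 0 / 1
coord 1F = + 10 / 1     , + 0 / 1
coord 2F = -[1+ 4 ] / 1 , + 9 / 1
coord 3F = -[1+ 4 ] / 1 , + 8 / 1
coord 4F = -[1+ 3 ] / 1 , + 7 / 1
coord 5F = -[1+ 3 ] / 1 , + 8 / 1
coord 6F = + 0 / 1      , + 20 / 1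
coord 7F = + 0 / 1      , + 10 / 1
coord 8F = + 5 / 1      , + 7 / 1

coord-injective : ∀ u v → coord u ≡ coord v → u ≡ v
coord-injective = toWitness {a? =
  all? λ u → all? λ v → ≡-dec ℚ._≟_ ℚ._≟_ (coord u) (coord v) →-dec u ≟ v} _

coord-InStrip : ∀ u → InStrip (coord u)
coord-InStrip = toWitness {a? = all? λ u →
  (tent (coord u) ℚ.≤? proj₂ (coord u)) ×-dec
  (proj₂ (coord u) ℚ.≤? tent (coord u) + tent (coord u))} _

tent-inner≢0 : ∀ (r : Fin 7) → tent (coord (suc (suc r))) ≢ 0ℚ
tent-inner≢0 = toWitness {a? = all? λ r → ¬? (tent (coord (suc (suc r))) ℚ.≟ 0ℚ)} _

tent-edge≢0 : ∀ u v → u ~₀ v → tent (coord u) ≢ 0ℚ ⊎ tent (coord v) ≢ 0ℚ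
tent-edge≢0 = toWitness {a? = all? λ u → all? λ v → u ~₀? v →-dec
  (¬? (tent (coord u) ℚ.≟ 0ℚ) ⊎-dec ¬? (tent (coord v) ℚ.≟ 0ℚ))} _

sameSign? : ∀ a b → Dec (SameSign a b)
sameSign? a b = ((0ℚ ℚ.≤? a) ×-dec (0ℚ ℚ.≤? b)) ⊎-dec ((a ℚ.≤? 0ℚ) ×-dec (b ℚ.≤? 0ℚ))

-- Vertices 6 and 7, the only links between the two sides, are placed on the axis `x = 0`; so each
-- edge stays in a half-plane where `tent` is affine.
edge-SameSign : ∀ u v → u ~₀ v → SameSign (proj₁ (coord u)) (proj₁ (coord v))
edge-SameSign = toWitness {a? = all? λ u → all? λ v → u ~₀? v →-dec
  sameSign? (proj₁ (coord u)) (proj₁ (coord v))} _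

-- No other vertex lies even on the line through an edge, so a nonzero signed area suffices as a
-- test.
vertex-off-edge : ∀ u v → u ~₀ v → ∀ w →
                  (w ≡ u ⊎ w ≡ v) ⊎ side (coord u) (coord v) (coord w) ≢ 0ℚ
vertex-off-edge = toWitness {a? = all? λ u → all? λ v → u ~₀? v →-dec all? λ w →
  (w ≟ u ⊎-dec w ≟ v) ⊎-dec ¬? (side (coord u) (coord v) (coord w) ℚ.≟ 0ℚ)} _

apart? : ∀ p q r s → Dec (Apart p q r s)
apart? p q r s =
  ((0ℚ ℚ.≤? side r s p * side r s q) ×-dec (¬? (side r s p ℚ.≟ 0ℚ) ⊎-dec ¬? (side r s q ℚ.≟ 0ℚ)))
  ⊎-dec (0ℚ ℚ.<? side p q r * side p q s)

-- Edges are ordered pairs here, so the same edge may also appear reversed. Distinct edges with a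
-- common end fall under the weak inequality in `Apart`.
edges-apart : ∀ u v → u ~₀ v → ∀ u′ v′ → u′ ~₀ v′ →
              (u ≡ u′ × v ≡ v′) ⊎ (u ≡ v′ × v ≡ u′) ⊎
              Apart (coord u) (coord v) (coord u′) (coord v′)
edges-apart = toWitness {a? = all? λ u → all? λ v → u ~₀? v →-dec
  all? λ u′ → all? λ v′ → u′ ~₀? v′ →-dec
  ((u ≟ u′ ×-dec v ≟ v′) ⊎-dec (u ≟ v′ ×-dec v ≟ u′) ⊎-dec
   apart? (coord u) (coord v) (coord u′) (coord v′))} _

edge-InStrip : ∀ u v z → u ~₀ v → OnSegment (coord u) (coord v) z → InStrip z
edge-InStrip u v z u~v = OnSegment⇒InStrip (coord u) (coord v) z (edge-SameSign u v u~v)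
                           (coord-InStrip u) (coord-InStrip v)

-- `tent` is non-negative at both ends of an edge and, the poles being non-adjacent, nonzero at one
-- of them.
tent≡0⇒endpoint : ∀ u v z → u ~₀ v → OnSegment (coord u) (coord v) z → tent z ≡ 0ℚ →
                  z ≡ coord u ⊎ z ≡ coord v
tent≡0⇒endpoint u v z u~v = zero⇒endpoint (coord u) (coord v) z tent
  (tent-affine (coord u) (coord v) (edge-SameSign u v u~v))
  (*-nonNeg (InStrip⇒0≤tent (coord u) (coord-InStrip u)) (InStrip⇒0≤tent (coord v) (coord-InStrip v)))
  (tent-edge≢0 u v u~v)

-- The vertices of k gadgets glued along their poles

data Address (k : ℕ) : Set where
  west east : Address k
  inner     : Fin k → Fin 7 → Address k

module _ {k : ℕ} where

  label : Address k → Fin 9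
  label west        = 0F
  label east        = 1F
  label (inner _ r) = suc (suc r)

  -- Whether some copy contains both vertices; a pole belongs to every copy.
  together : Address k → Address k → Bool
  together (inner i _) (inner j _) = does (i ≟ j)
  together west        _           = true
  together east        _           = true
  together (inner _ _) west        = true
  together (inner _ _) east        = true

  adjᴬ : Address k → Address k → Bool
  adjᴬ x y = together x y ∧ adj₀ (label x) (label y)

  infix 4 _~ᴬ_
  _~ᴬ_ : Address k → Address k → Set
  x ~ᴬ y = T (adjᴬ x y)

  together-sym : ∀ x y → together x y ≡ together y x
  together-sym west        west        = refl
  together-sym west        east        = refl
  together-sym west        (inner _ _) = refl
  together-sym east        west        = refl
  together-sym east        east        = refl
  together-sym east        (inner _ _) = refl
  together-sym (inner _ _) west        = refl
  together-sym (inner _ _) east        = refl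
  together-sym (inner i _) (inner j _) = does-⇔ (mk⇔ sym sym) (i ≟ j) (j ≟ i)

  adjᴬ-sym : ∀ x y → adjᴬ x y ≡ adjᴬ y x
  adjᴬ-sym x y = cong₂ _∧_ (together-sym x y) (adj₀-sym (label x) (label y))

  adjᴬ-irrefl : ∀ x → adjᴬ x x ≡ false
  adjᴬ-irrefl x = trans (cong (together x x ∧_) (adj₀-irrefl (label x))) (∧-zeroʳ (together x x))

  ~ᴬ⇒~₀ : ∀ x y → x ~ᴬ y → label x ~₀ label y
  ~ᴬ⇒~₀ x y x~y = proj₂ (Equivalence.to T-∧ x~y)

  ~ᴬ⇒same-copy : ∀ i r j s → inner i r ~ᴬ inner j s → i ≡ j
  ~ᴬ⇒same-copy i _ j _ x~y with i ≟ j
  ... | yes i≡j = i≡j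

  at : Fin k → Fin 9 → Address k
  at i 0F            = west
  at i 1F            = east
  at i (suc (suc r)) = inner i r

  -- Writing both ends as `at copy` of their labels treats poles and inner vertices alike, so that
  -- facts about the gadget apply to labels.
  record InCopy (x y : Address k) : Set where
    field
      copy   : Fin k
      x-at   : x ≡ at copy (label x)
      y-at   : y ≡ at copy (label y)
      joined : label x ~₀ label y

  -- The poles are not adjacent, so every edge has an inner end, and that end determines the copy.
  edge-in-copy : ∀ x y → x ~ᴬ y → InCopy x y
  edge-in-copy west        (inner i r) x~y = record { copy = i; x-at = refl; y-at = refl; joined = x~y }
  edge-in-copy east        (inner i r) x~y = record { copy = i; x-at = refl; y-at = refl; joined = x~y }
  edge-in-copy (inner i r) west        x~y = record { copy = i; x-at = refl; y-at = refl; joined = x~y }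
  edge-in-copy (inner i r) east        x~y = record { copy = i; x-at = refl; y-at = refl; joined = x~y }
  edge-in-copy (inner i r) (inner j s) x~y = record
    { copy = i; x-at = refl; y-at = cong (λ i → inner i s) (sym (~ᴬ⇒same-copy i r j s x~y))
    ; joined = ~ᴬ⇒~₀ (inner i r) (inner j s) x~y }

  ~ᴬ-sym : ∀ x y → x ~ᴬ y → y ~ᴬ x
  ~ᴬ-sym x y = subst T (adjᴬ-sym x y)

  data Pole : Address k → Set where
    west : Pole west
    east : Pole east

  pole-or-inner : ∀ x → Pole x ⊎ ∃[ i ] ∃[ r ] x ≡ inner i r
  pole-or-inner west        = inj₁ west
  pole-or-inner east        = inj₁ east
  pole-or-inner (inner i r) = inj₂ (i , r , refl)

  adjacent-pole-unique : ∀ {x y} z → Pole x → Pole y → x ~ᴬ z → y ~ᴬ z → x ≡ y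
  adjacent-pole-unique z west west x~z y~z = refl
  adjacent-pole-unique z west east x~z y~z = contradiction y~z (poles-far-apart (label z) x~z)
  adjacent-pole-unique z east west x~z y~z = contradiction x~z (poles-far-apart (label z) y~z)
  adjacent-pole-unique z east east x~z y~z = refl

  -- Two distinct vertices x and z with the same label lie in different copies, so both
  -- paths x y z and x v u z pass through a pole; these poles are distinct, but no label
  -- is adjacent to both.
  no-fold : ∀ x y z u v → x ~ᴬ y → y ~ᴬ z → z ~ᴬ u → u ~ᴬ v → v ~ᴬ x →
            x ≢ z → y ≢ u → y ≢ v → label x ≢ label z
  no-fold west _ west _ _ _ _ _ _ _ x≢z _ _ _ = x≢z refl
  no-fold east _ east _ _ _ _ _ _ _ x≢z _ _ _ = x≢z refl
  no-fold x@(inner i r) y z@(inner j .r) u v x~y y~z z~u u~v v~x x≢z y≢u y≢v refl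
    with pole-or-inner y | pole-or-inner u | pole-or-inner v
  ... | inj₂ (l , s , refl) | _ | _ =
    x≢z (cong (λ i → inner i r) (trans (~ᴬ⇒same-copy i r l s x~y) (~ᴬ⇒same-copy l s j r y~z)))
  ... | inj₁ y-pole | inj₁ u-pole | _ =
    y≢u (adjacent-pole-unique z y-pole u-pole y~z (~ᴬ-sym z u z~u))
  ... | inj₁ y-pole | inj₂ _ | inj₁ v-pole =
    y≢v (adjacent-pole-unique x y-pole v-pole (~ᴬ-sym x y x~y) v~x)
  ... | inj₁ _ | inj₂ (l , s , refl) | inj₂ (m , t , refl) =
    x≢z (cong (λ i → inner i r) (sym
      (trans (~ᴬ⇒same-copy j r l s z~u)
        (trans (~ᴬ⇒same-copy l s m t u~v) (~ᴬ⇒same-copy m t i r v~x)))))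

  -- The drawing of the glued graph

  embed : Address k → Point
  embed west        = coord 0F
  embed east        = coord 1F
  embed (inner i r) = scale (weight (toℕ i)) (coord (suc (suc r)))

  -- The poles have ordinate 0 and are fixed by every scaling, so each copy is a scaled gadget
  -- including its poles.
  embed-at : ∀ i u → embed (at i u) ≡ scale (weight (toℕ i)) (coord u)
  embed-at i 0F            = cong (proj₁ (coord 0F) ,_) (sym (ℚ.*-zeroʳ (weight (toℕ i))))
  embed-at i 1F            = cong (proj₁ (coord 1F) ,_) (sym (ℚ.*-zeroʳ (weight (toℕ i))))
  embed-at i (suc (suc r)) = refl

  embed-at-injective : ∀ i u v → embed (at i u) ≡ embed (at i v) → u ≡ v
  embed-at-injective i u v eq = coord-injective u v
    (scale-injective (weight (toℕ i)) {{weight-pos (toℕ i)}}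
      (trans (sym (embed-at i u)) (trans eq (embed-at i v))))

  embed-injective : ∀ x y → embed x ≡ embed y → x ≡ y
  embed-injective west      west      eq = refl
  embed-injective west      east      eq = contradiction (coord-injective 0F 1F eq) λ ()
  embed-injective west        (inner i r) eq = contradiction (embed-at-injective i 0F (suc (suc r)) eq) λ ()
  embed-injective east      west      eq = contradiction (coord-injective 1F 0F eq) λ ()
  embed-injective east      east      eq = refl
  embed-injective east        (inner i r) eq = contradiction (embed-at-injective i 1F (suc (suc r)) eq) λ ()
  embed-injective (inner i r) west      eq = contradiction (embed-at-injective i (suc (suc r)) 0F eq) λ ()
  embed-injective (inner i r) east      eq = contradiction (embed-at-injective i (suc (suc r)) 1F eq) λ ()
  embed-injective (inner i r) (inner j s) eq with i ≟ j
  ... | yes refl = cong (at i) (embed-at-injective i (suc (suc r)) (suc (suc s)) eq)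
  -- Different copies can meet only where `tent` vanishes, which excludes inner vertices.
  ... | no i≢j   = contradiction
    (strips-meet (coord (suc (suc r))) (coord (suc (suc s))) (i≢j ∘ Finₚ.toℕ-injective)
      (coord-InStrip (suc (suc r))) (coord-InStrip (suc (suc s))) eq)
    (tent-inner≢0 r)

  module _ (x y : Address k) (x~y : x ~ᴬ y) where
    open InCopy (edge-in-copy x y x~y)

    private
      w = weight (toℕ copy)
      u = label x
      v = label y

      embed-x : embed x ≡ scale w (coord u)
      embed-x = trans (cong embed x-at) (embed-at copy u)

      embed-y : embed y ≡ scale w (coord v)
      embed-y = trans (cong embed y-at) (embed-at copy v)

    unscale-edge : ∀ z → OnSegment (embed x) (embed y) z →
                   ∃[ z′ ] z ≡ scale w z′ × OnSegment (coord u) (coord v) z′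
    unscale-edge z z∈xy = unscale w (coord u) (coord v) z
      (subst₂ (λ p q → OnSegment p q z) embed-x embed-y z∈xy)

    rescale-endpoint : ∀ {z z′} → z ≡ scale w z′ → z′ ≡ coord u ⊎ z′ ≡ coord v →
                       z ≡ embed x ⊎ z ≡ embed y
    rescale-endpoint z≡ (inj₁ refl) = inj₁ (trans z≡ (sym embed-x))
    rescale-endpoint z≡ (inj₂ refl) = inj₂ (trans z≡ (sym embed-y))

    at⇒endpoint : ∀ b → OnSegment (embed x) (embed y) (embed (at copy b)) →
                  at copy b ≡ x ⊎ at copy b ≡ y
    at⇒endpoint b on = [ Sum.map (at-label x-at) (at-label y-at) , contradiction side≡0 ]′
                         (vertex-off-edge u v joined b)
      where
      at-label : ∀ {a} → a ≡ at copy (label a) → b ≡ label a → at copy b ≡ a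
      at-label a-at b≡ = trans (cong (at copy) b≡) (sym a-at)
      unscaled = unscale-edge (embed (at copy b)) on
      z′ = proj₁ unscaled
      coord-b≡z′ : coord b ≡ z′
      coord-b≡z′ = scale-injective w {{weight-pos (toℕ copy)}}
        (trans (sym (embed-at copy b)) (proj₁ (proj₂ unscaled)))
      side≡0 : side (coord u) (coord v) (coord b) ≡ 0ℚ
      side≡0 = trans (cong (side (coord u) (coord v)) coord-b≡z′)
        (OnSegment⇒side≡0 (coord u) (coord v) z′ (proj₂ (proj₂ unscaled)))

    -- A pole, or an inner vertex of the edge's own copy, is handled inside the gadget; an inner
    -- vertex of another copy is kept away by the strips.
    embed-no-vertex : ∀ a → OnSegment (embed x) (embed y) (embed a) → a ≡ x ⊎ a ≡ y
    embed-no-vertex west        on = at⇒endpoint 0F on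
    embed-no-vertex east        on = at⇒endpoint 1F on
    embed-no-vertex (inner i r) on = go (i ≟ copy)
      where
      unscaled = unscale-edge (embed (inner i r)) on
      z′ = proj₁ unscaled
      go : Dec (i ≡ copy) → inner i r ≡ x ⊎ inner i r ≡ y
      go (yes i≡copy) = subst (λ i → inner i r ≡ x ⊎ inner i r ≡ y) (sym i≡copy)
        (at⇒endpoint (suc (suc r)) (subst (λ i → OnSegment (embed x) (embed y) (embed (inner i r))) i≡copy on))
      go (no i≢copy) = contradiction
        (strips-meet (coord (suc (suc r))) z′ (i≢copy ∘ Finₚ.toℕ-injective)
          (coord-InStrip (suc (suc r))) (edge-InStrip u v z′ joined (proj₂ (proj₂ unscaled)))
          (proj₁ (proj₂ unscaled)))
        (tent-inner≢0 r)

  -- Within one copy the point is pulled back to the gadget and `edges-apart` decides. Between two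
  -- copies its tent height is 0, which leaves only the ends of the edge.
  embed-no-cross : ∀ x y x′ y′ → x ~ᴬ y → x′ ~ᴬ y′ →
    ∀ z → OnSegment (embed x) (embed y) z → OnSegment (embed x′) (embed y′) z →
    (x ≡ x′ × y ≡ y′) ⊎ (x ≡ y′ × y ≡ x′) ⊎ (z ≡ embed x ⊎ z ≡ embed y)
  embed-no-cross x y x′ y′ x~y x′~y′ z z∈xy z∈x′y′ = go (i ≟ j)
    where
    open InCopy (edge-in-copy x y x~y) renaming (copy to i)
    open InCopy (edge-in-copy x′ y′ x′~y′)
      renaming (copy to j; x-at to x′-at; y-at to y′-at; joined to joined′)
    p  = unscale-edge x y x~y z z∈xy
    p′ = unscale-edge x′ y′ x′~y′ z z∈x′y′
    z₁ = proj₁ p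
    z₂ = proj₁ p′
    z₁-on = proj₂ (proj₂ p)
    z₂-on = proj₂ (proj₂ p′)
    meet : scale (weight (toℕ i)) z₁ ≡ scale (weight (toℕ j)) z₂
    meet = trans (sym (proj₁ (proj₂ p))) (proj₁ (proj₂ p′))
    transport : i ≡ j → ∀ {a b} → a ≡ at i (label a) → b ≡ at j (label b) → label a ≡ label b → a ≡ b
    transport i≡j a-at b-at eq = trans a-at (trans (cong₂ at i≡j eq) (sym b-at))
    Goal : Set
    Goal = (x ≡ x′ × y ≡ y′) ⊎ (x ≡ y′ × y ≡ x′) ⊎ (z ≡ embed x ⊎ z ≡ embed y)
    same-copy : i ≡ j →
      (label x ≡ label x′ × label y ≡ label y′) ⊎ (label x ≡ label y′ × label y ≡ label x′) ⊎
      Apart (coord (label x)) (coord (label y)) (coord (label x′)) (coord (label y′)) → Goal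
    same-copy i≡j (inj₁ (eq , eq′)) =
      inj₁ (transport i≡j x-at x′-at eq , transport i≡j y-at y′-at eq′)
    same-copy i≡j (inj₂ (inj₁ (eq , eq′))) =
      inj₂ (inj₁ (transport i≡j x-at y′-at eq , transport i≡j y-at x′-at eq′))
    same-copy i≡j (inj₂ (inj₂ apart)) = inj₂ (inj₂ (rescale-endpoint x y x~y (proj₁ (proj₂ p))
      (apart⇒endpoint (coord (label x)) (coord (label y)) (coord (label x′)) (coord (label y′)) z₁
        apart z₁-on (subst (OnSegment (coord (label x′)) (coord (label y′))) (sym z₁≡z₂) z₂-on))))
      where
      z₁≡z₂ : z₁ ≡ z₂
      z₁≡z₂ = scale-injective (weight (toℕ i)) {{weight-pos (toℕ i)}}
                (trans meet (cong (λ l → scale (weight (toℕ l)) z₂) (sym i≡j)))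
    go : Dec (i ≡ j) → Goal
    go (no i≢j) = inj₂ (inj₂ (rescale-endpoint x y x~y (proj₁ (proj₂ p))
      (tent≡0⇒endpoint (label x) (label y) z₁ joined z₁-on
        (strips-meet z₁ z₂ (i≢j ∘ Finₚ.toℕ-injective)
          (edge-InStrip (label x) (label y) z₁ joined z₁-on)
          (edge-InStrip (label x′) (label y′) z₂ joined′ z₂-on) meet))))
    go (yes i≡j) = same-copy i≡j (edges-apart (label x) (label y) joined (label x′) (label y′) joined′)

-- Counting

⟦_⟧ : Bool → ℕ
⟦ b ⟧ = if b then 1 else 0

sum-const : ∀ n c → sum {n} (λ _ → c) ≡ n ℕ.* c
sum-const ℕ.zero    c = refl
sum-const (ℕ.suc n) c = cong (c ℕ.+_) (sum-const n c)

sum-δ : ∀ {n} (i : Fin n) c → sum (λ j → if does (i ≟ j) then c else 0) ≡ c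
sum-δ {ℕ.suc n} zero    c = trans (cong (c ℕ.+_) (sum-replicate-zero n)) (ℕ.+-identityʳ c)
sum-δ {ℕ.suc n} (suc i) c = sum-δ i c

sum-↑ : ∀ m {n} (f : Fin (m ℕ.+ n) → ℕ) → sum f ≡ sum (λ i → f (i ↑ˡ n)) ℕ.+ sum (λ j → f (m ↑ʳ j))
sum-↑ ℕ.zero    f = refl
sum-↑ (ℕ.suc m) f = trans (cong (f zero ℕ.+_) (sum-↑ m (f ∘ suc))) (sym (ℕ.+-assoc (f zero) _ _))

sum-combine : ∀ m {n} (f : Fin (m ℕ.* n) → ℕ) → sum f ≡ sum (λ i → sum (λ j → f (combine {m} {n} i j)))
sum-combine ℕ.zero        f = refl
sum-combine (ℕ.suc m) {n} f =
  trans (sum-↑ n f) (cong (sum (λ j → f (j ↑ˡ (m ℕ.* n))) ℕ.+_) (sum-combine m (λ j → f (n ↑ʳ j))))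

module _ {A B : Set} {P : Pred (A × B) 0ℓ} (P? : Decidable P) where

  length-filter-row : ∀ {n} x (g : Fin n → B) →
    length (filter P? (map (x ,_) (tabulate g))) ≡ sum (λ j → ⟦ does (P? (x , g j)) ⟧)
  length-filter-row {ℕ.zero}  x g = refl
  length-filter-row {ℕ.suc n} x g with does (P? (x , g zero))
  ... | true  = cong ℕ.suc (length-filter-row x (g ∘ suc))
  ... | false = length-filter-row x (g ∘ suc)

  length-filter-cartesianProduct : ∀ {m n} (f : Fin m → A) (g : Fin n → B) →
    length (filter P? (cartesianProduct (tabulate f) (tabulate g))) ≡
    sum (λ i → sum (λ j → ⟦ does (P? (f i , g j)) ⟧))
  length-filter-cartesianProduct {ℕ.zero}  f g = refl
  length-filter-cartesianProduct {ℕ.suc m} f g = begin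
    length (filter P? (row ++ rest))                   ≡⟨ cong length (filter-++ P? row rest) ⟩
    length (filter P? row ++ filter P? rest)           ≡⟨ length-++ (filter P? row) ⟩
    length (filter P? row) ℕ.+ length (filter P? rest) ≡⟨ cong₂ ℕ._+_ (length-filter-row (f zero) g)
                                                            (length-filter-cartesianProduct (f ∘ suc) g) ⟩
    sum (λ i → sum (λ j → ⟦ does (P? (f i , g j)) ⟧))  ∎
    where
    open ≡-Reasoning
    row  = map (f zero ,_) (tabulate g)
    rest = cartesianProduct (tabulate (f ∘ suc)) (tabulate g)

combine-<? : ∀ {m n} (i : Fin m) (r s : Fin n) → does (combine i r <? combine i s) ≡ does (r <? s)
combine-<? {n = n} i r s = does-⇔ (mk⇔ cancel mono) (combine i r <? combine i s) (r <? s)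
  where
  cancel : combine i r Fin.< combine i s → r Fin.< s
  cancel lt = ℕ.+-cancelˡ-< (n ℕ.* toℕ i) _ _ (subst₂ ℕ._<_ (toℕ-combine i r) (toℕ-combine i s) lt)
  mono : r Fin.< s → combine i r Fin.< combine i s
  mono lt = subst₂ ℕ._<_ (sym (toℕ-combine i r)) (sym (toℕ-combine i s)) (ℕ.+-monoʳ-< (n ℕ.* toℕ i) lt)

-- The glued graph

-- Both proof fields have at most one inhabitant, so the endpoints determine the edge.
Edge-≡ : ∀ {n} {G : SimpleGraph n} {a b : Edge G} →
         Edge.src a ≡ Edge.src b → Edge.tgt a ≡ Edge.tgt b → a ≡ b
Edge-≡ {a = record { src = u; tgt = v; src<tgt = p; adjacent = c }}
       {b = record { src<tgt = q; adjacent = d }} refl refl =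
  cong₂ (λ p c → record { src = u; tgt = v; src<tgt = p; adjacent = c })
    (Finₚ.<-irrelevant p q) (T-irrelevant c d)

module Bouquet (k : ℕ) where

  address : Fin (2 ℕ.+ k ℕ.* 7) → Address k
  address 0F            = west
  address 1F            = east
  address (suc (suc v)) = uncurry inner (remQuot 7 v)

  vertex : Address k → Fin (2 ℕ.+ k ℕ.* 7)
  vertex west        = 0F
  vertex east        = 1F
  vertex (inner i r) = suc (suc (combine i r))

  vertex-address : ∀ v → vertex (address v) ≡ v
  vertex-address 0F            = refl
  vertex-address 1F            = refl
  vertex-address (suc (suc v)) = cong (λ v → suc (suc v)) (combine-remQuot {k} 7 v)

  address-vertex : ∀ x → address (vertex x) ≡ x
  address-vertex west        = refl
  address-vertex east        = refl
  address-vertex (inner i r) = cong (uncurry inner) (remQuot-combine i r)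

  address-injective : ∀ {u v} → address u ≡ address v → u ≡ v
  address-injective {u} {v} eq =
    trans (sym (vertex-address u)) (trans (cong vertex eq) (vertex-address v))

  bouquet : SimpleGraph (2 ℕ.+ k ℕ.* 7)
  bouquet = record
    { adj        = λ u v → adjᴬ (address u) (address v)
    ; adj-sym    = λ u v → adjᴬ-sym (address u) (address v)
    ; adj-irrefl = λ v → adjᴬ-irrefl (address v)
    }

  pos : Fin (2 ℕ.+ k ℕ.* 7) → Point
  pos v = embed (address v)

  pos-injective : ∀ {u v} → pos u ≡ pos v → u ≡ v
  pos-injective {u} {v} eq = address-injective (embed-injective (address u) (address v) eq)

  open Edge

  no-cross : ∀ (a b : Edge bouquet) → a ≢ b → ∀ z →
    OnSegment (pos (src a)) (pos (tgt a)) z → OnSegment (pos (src b)) (pos (tgt b)) z →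
    z ≡ pos (src a) ⊎ z ≡ pos (tgt a)
  no-cross a b a≢b z z∈a z∈b = distinct
    (embed-no-cross (address (src a)) (address (tgt a)) (address (src b)) (address (tgt b))
      (adjacent a) (adjacent b) z z∈a z∈b)
    where
    distinct : (address (src a) ≡ address (src b) × address (tgt a) ≡ address (tgt b)) ⊎
               (address (src a) ≡ address (tgt b) × address (tgt a) ≡ address (src b)) ⊎
               (z ≡ pos (src a) ⊎ z ≡ pos (tgt a)) →
               z ≡ pos (src a) ⊎ z ≡ pos (tgt a)
    distinct (inj₁ (s≡s , t≡t)) =
      contradiction (Edge-≡ (address-injective s≡s) (address-injective t≡t)) a≢b
    -- Two edges cannot be reverses of each other, since both satisfy `src < tgt`.
    distinct (inj₂ (inj₁ (s≡t , t≡s))) = contradiction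
      (subst₂ Fin._<_ (address-injective s≡t) (address-injective t≡s) (src<tgt a))
      (ℕ.<-asym (src<tgt b))
    distinct (inj₂ (inj₂ endpoint)) = endpoint

  planeBouquet : PlaneGraph (2 ℕ.+ k ℕ.* 7)
  planeBouquet = record
    { graph         = bouquet
    ; pos           = pos
    ; pos-injective = pos-injective
    ; arc           = λ a → segment (pos (src a)) (pos (tgt a))
    ; arc-isArc     = λ a eq → Finₚ.<⇒≢ (src<tgt a) (pos-injective eq)
    ; no-vertex     = λ a w on → Sum.map address-injective address-injective
        (embed-no-vertex (address (src a)) (address (tgt a)) (adjacent a) (address w) on)
    ; no-cross      = no-cross
    }

  -- Forbidden subgraphs

  K₄-free : ¬ (K 4 ⊑ bouquet)
  K₄-free (f , _ , hom) =
    no-K₄ (l 0F) (l 1F) (l~ 0F 1F _) (l 2F) (l~ 0F 2F _) (l~ 1F 2F _)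
          (l 3F) (l~ 0F 3F _) (l~ 1F 3F _) (l~ 2F 3F _)
    where
    l : Fin 4 → Fin 9
    l = label ∘ address ∘ f
    l~ : ∀ i j → SimpleGraph._~_ (K 4) i j → l i ~₀ l j
    l~ i j i~j = ~ᴬ⇒~₀ (address (f i)) (address (f j)) (hom i j i~j)

  -- The labels of a 5-cycle form a closed walk in the gadget, which must repeat a label two steps
  -- apart; `no-fold` excludes this for distinct vertices.
  C₅-free : ¬ (C₅ ⊑ bouquet)
  C₅-free (f , f-inj , hom) = unfold
    (closed-5-walk-folds (label (x 0F)) (label (x 1F)) (x~₀ 0F 1F _) (label (x 2F)) (x~₀ 1F 2F _)
      (label (x 3F)) (x~₀ 2F 3F _) (label (x 4F)) (x~₀ 3F 4F _) (x~₀ 4F 0F _))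
    where
    open SimpleGraph C₅ using (_~_)
    x : Fin 5 → Address k
    x = address ∘ f
    x~₀ : ∀ i j → i ~ j → label (x i) ~₀ label (x j)
    x~₀ i j i~j = ~ᴬ⇒~₀ (x i) (x j) (hom i j i~j)
    fold : ∀ a b c d e → a ~ b → b ~ c → c ~ d → d ~ e → e ~ a →
           a ≢ c → b ≢ d → b ≢ e → label (x a) ≢ label (x c)
    fold a b c d e a~b b~c c~d d~e e~a a≢c b≢d b≢e =
      no-fold (x a) (x b) (x c) (x d) (x e)
        (hom a b a~b) (hom b c b~c) (hom c d c~d) (hom d e d~e) (hom e a e~a)
        (a≢c ∘ x-inj) (b≢d ∘ x-inj) (b≢e ∘ x-inj)
      where
      x-inj : ∀ {i j} → x i ≡ x j → i ≡ j
      x-inj = f-inj ∘ address-injective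
    unfold : ¬ (label (x 0F) ≡ label (x 2F) ⊎ label (x 1F) ≡ label (x 3F) ⊎ label (x 2F) ≡ label (x 4F) ⊎
                label (x 3F) ≡ label (x 0F) ⊎ label (x 4F) ≡ label (x 1F))
    -- The five possible repetitions are rotations of one another along the cycle.
    unfold (inj₁ eq)                      = fold 0F 1F 2F 3F 4F _ _ _ _ _ (λ ()) (λ ()) (λ ()) eq
    unfold (inj₂ (inj₁ eq))               = fold 1F 2F 3F 4F 0F _ _ _ _ _ (λ ()) (λ ()) (λ ()) eq
    unfold (inj₂ (inj₂ (inj₁ eq)))        = fold 2F 3F 4F 0F 1F _ _ _ _ _ (λ ()) (λ ()) (λ ()) eq
    unfold (inj₂ (inj₂ (inj₂ (inj₁ eq)))) = fold 3F 4F 0F 1F 2F _ _ _ _ _ (λ ()) (λ ()) (λ ()) eq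
    unfold (inj₂ (inj₂ (inj₂ (inj₂ eq)))) = fold 4F 0F 1F 2F 3F _ _ _ _ _ (λ ()) (λ ()) (λ ()) eq


  -- Number of edges

  cell : (u v : Fin (2 ℕ.+ k ℕ.* 7)) → ℕ
  cell u v = ⟦ does (u <? v) ∧ adjᴬ (address u) (address v) ⟧

  sum-vertices : ∀ (f : Fin (2 ℕ.+ k ℕ.* 7) → ℕ) →
    sum f ≡ f 0F ℕ.+ (f 1F ℕ.+ sum (λ i → sum (λ r → f (vertex (inner i r)))))
  sum-vertices f = cong (λ t → f 0F ℕ.+ (f 1F ℕ.+ t)) (sum-combine k (λ v → f (suc (suc v))))

  degree-west : sum (cell 0F) ≡ k ℕ.* 4
  degree-west = trans (sum-vertices (cell 0F)) (trans
    (sum-cong-≗ λ i → sum-cong-≗ λ r → cong (λ x → ⟦ adjᴬ west x ⟧) (address-vertex (inner i r)))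
    -- The sum over one copy evaluates to 4, the degree of pole 0 in the gadget.
    (sum-const k 4))

  degree-east : sum (cell 1F) ≡ k ℕ.* 3
  degree-east = trans (sum-vertices (cell 1F)) (trans
    (sum-cong-≗ λ i → sum-cong-≗ λ r → cong (λ x → ⟦ adjᴬ east x ⟧) (address-vertex (inner i r)))
    (sum-const k 3))

  upDegree : Fin 7 → ℕ
  upDegree r = sum (λ s → ⟦ does (r <? s) ∧ adj₀ (suc (suc r)) (suc (suc s)) ⟧)

  cell-inner : ∀ i r j s → cell (vertex (inner i r)) (vertex (inner j s)) ≡
    ⟦ does (combine i r <? combine j s) ∧ adjᴬ (inner i r) (inner j s) ⟧
  cell-inner i r j s = cong₂ (λ x y → ⟦ does (combine i r <? combine j s) ∧ adjᴬ x y ⟧)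
    (address-vertex (inner i r)) (address-vertex (inner j s))

  -- Inner vertices of different copies are never adjacent; inside one copy the numbering by
  -- `combine` preserves the order of the labels.
  upDegree-in-copy : ∀ i r j → sum (λ s → cell (vertex (inner i r)) (vertex (inner j s))) ≡
                     (if does (i ≟ j) then upDegree r else 0)
  upDegree-in-copy i r j = trans (sum-cong-≗ (cell-inner i r j)) (by-copy j)
    where
    by-copy : ∀ j → sum (λ s → ⟦ does (combine i r <? combine j s) ∧ adjᴬ (inner i r) (inner j s) ⟧) ≡
              (if does (i ≟ j) then upDegree r else 0)
    by-copy j with i ≟ j
    ... | yes refl = sum-cong-≗ λ s →
      cong (λ b → ⟦ b ∧ adj₀ (suc (suc r)) (suc (suc s)) ⟧) (combine-<? i r s)
    ... | no _     = trans
      (sum-cong-≗ λ s → cong ⟦_⟧ (∧-zeroʳ (does (combine i r <? combine j s))))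
      (sum-replicate-zero 7)

  degree-inner : ∀ i r → sum (cell (vertex (inner i r))) ≡ upDegree r
  degree-inner i r = trans (sum-vertices (cell (vertex (inner i r)))) (trans
    (sum-cong-≗ (upDegree-in-copy i r)) (sum-δ i (upDegree r)))

  e-bouquet : e bouquet ≡ k ℕ.* 15
  e-bouquet = begin
    e bouquet
      ≡⟨ length-filter-cartesianProduct
           (λ p → (proj₁ p <? proj₂ p) ×-dec T? (SimpleGraph.adj bouquet (proj₁ p) (proj₂ p))) id id ⟩
    sum (λ u → sum (cell u))
      ≡⟨ sum-vertices (λ u → sum (cell u)) ⟩
    sum (cell 0F) ℕ.+ (sum (cell 1F) ℕ.+ sum (λ i → sum (λ r → sum (cell (vertex (inner i r))))))
      -- Of the 15 gadget edges, 4 meet the first pole, 3 the second, and the remaining 8 join inner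
      -- vertices; each is counted at its smaller end.
      ≡⟨ cong₂ ℕ._+_ degree-west (cong₂ ℕ._+_ degree-east
           (trans (sum-cong-≗ λ i → sum-cong-≗ (degree-inner i)) (sum-const k 8))) ⟩
    k ℕ.* 4 ℕ.+ (k ℕ.* 3 ℕ.+ k ℕ.* 8)
      ≡⟨ cong (k ℕ.* 4 ℕ.+_) (ℕ.*-distribˡ-+ k 3 8) ⟨
    k ℕ.* 4 ℕ.+ k ℕ.* 11
      ≡⟨ ℕ.*-distribˡ-+ k 4 11 ⟨
    k ℕ.* 15 ∎
    where open ≡-Reasoning

-- The edge count as an identity of rationals

toℚᵘ-/1 : ∀ i → toℚᵘ (i / 1) ℚᵘ.≃ ℚᵘ.mkℚᵘ i 0
toℚᵘ-/1 i = ℚ.toℚᵘ-fromℚᵘ (ℚᵘ.mkℚᵘ i 0)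

-- `_/_` normalises by a gcd that does not reduce on variables, so the comparison is made on
-- unnormalised fractions.
/1-homo-+ : ∀ i j → (i ℤ.+ j) / 1 ≡ i / 1 + j / 1
/1-homo-+ i j = ℚ.toℚᵘ-injective (begin-equality
  toℚᵘ ((i ℤ.+ j) / 1)                 ≃⟨ toℚᵘ-/1 (i ℤ.+ j) ⟩
  ℚᵘ.mkℚᵘ (i ℤ.+ j) 0                  ≡⟨ cong (λ n → ℚᵘ.mkℚᵘ n 0)
                                            (cong₂ ℤ._+_ (ℤ.*-identityʳ i) (ℤ.*-identityʳ j)) ⟨
  ℚᵘ.mkℚᵘ i 0 ℚᵘ.+ ℚᵘ.mkℚᵘ j 0         ≃⟨ ℚᵘ.+-cong (toℚᵘ-/1 i) (toℚᵘ-/1 j) ⟨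
  toℚᵘ (i / 1) ℚᵘ.+ toℚᵘ (j / 1)       ≃⟨ ℚ.toℚᵘ-homo-+ (i / 1) (j / 1) ⟨
  toℚᵘ (i / 1 + j / 1)                 ∎)
  where open ℚᵘ.≤-Reasoning

/1-homo-* : ∀ i j → (i ℤ.* j) / 1 ≡ (i / 1) * (j / 1)
/1-homo-* i j = ℚ.toℚᵘ-injective (begin-equality
  toℚᵘ ((i ℤ.* j) / 1)                 ≃⟨ toℚᵘ-/1 (i ℤ.* j) ⟩
  ℚᵘ.mkℚᵘ i 0 ℚᵘ.* ℚᵘ.mkℚᵘ j 0         ≃⟨ ℚᵘ.*-cong (toℚᵘ-/1 i) (toℚᵘ-/1 j) ⟨
  toℚᵘ (i / 1) ℚᵘ.* toℚᵘ (j / 1)       ≃⟨ ℚ.toℚᵘ-homo-* (i / 1) (j / 1) ⟨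
  toℚᵘ ((i / 1) * (j / 1))             ∎)
  where open ℚᵘ.≤-Reasoning

-- Pushing the cast through sums and products leaves `15x = 15/7 * (2 + 7x - 2)` with `x = k / 1`, a
-- task for the ring solver.
edge-density : ∀ k → + (k ℕ.* 15) / 1 ≡ (+ 15 / 7) * (+ (2 ℕ.+ k ℕ.* 7) / 1 - + 2 / 1)
edge-density k = begin
  + (k ℕ.* 15) / 1                            ≡⟨ cong (_/ 1) (ℤ.pos-* k 15) ⟩
  (+ k ℤ.* + 15) / 1                          ≡⟨ /1-homo-* (+ k) (+ 15) ⟩
  (+ k / 1) * (+ 15 / 1)                      ≡⟨ solve 1 (λ x → x :* con (+ 15 / 1)
                                                   := con (+ 15 / 7) :* (con (+ 2 / 1) :+ x :* con (+ 7 / 1) :- con (+ 2 / 1)))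
                                                   refl (+ k / 1) ⟩
  (+ 15 / 7) * (+ 2 / 1 + (+ k / 1) * (+ 7 / 1) - + 2 / 1)
    ≡⟨ cong (λ x → (+ 15 / 7) * (+ 2 / 1 + x - + 2 / 1)) (/1-homo-* (+ k) (+ 7)) ⟨
  (+ 15 / 7) * (+ 2 / 1 + (+ k ℤ.* + 7) / 1 - + 2 / 1)
    ≡⟨ cong (λ x → (+ 15 / 7) * (x - + 2 / 1)) (/1-homo-+ (+ 2) (+ k ℤ.* + 7)) ⟨
  (+ 15 / 7) * ((+ 2 ℤ.+ + k ℤ.* + 7) / 1 - + 2 / 1)
    ≡⟨ cong (λ i → (+ 15 / 7) * ((+ 2 ℤ.+ i) / 1 - + 2 / 1)) (ℤ.pos-* k 7) ⟨
  (+ 15 / 7) * (+ (2 ℕ.+ k ℕ.* 7) / 1 - + 2 / 1) ∎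
  where open ≡-Reasoning

-- The conclusion as a family over `n`, to be transported along `n = 2 + 7k`.
Extremal : ℕ → Set
Extremal n = Σ (PlaneGraph n) λ G → ¬ (K 4 ⊑ graph G) × ¬ (C₅ ⊑ graph G) ×
  ((+ e (graph G)) / 1 ≡ ((+ 15) / 7) * ((+ n) / 1 - (+ 2) / 1))

extremal : ∀ k → Extremal (2 ℕ.+ k ℕ.* 7)
extremal k = planeBouquet , K₄-free , C₅-free , trans (cong (λ m → + m / 1) e-bouquet) (edge-density k)
  where open Bouquet k

theorem2 : (n : ℕ) → n ≥ 9 → n % 7 ≡ 2 →
    Σ (PlaneGraph n) λ G → ¬ (K 4 ⊑ graph G) × ¬ (C₅ ⊑ graph G) ×
    ((+ e (graph G)) / 1 ≡ ((+ 15) / 7) * ((+ n) / 1 - (+ 2) / 1))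
-- The number of copies is the quotient of `n` by 7, and the remainder 2 accounts for the poles.
theorem2 n _ n%7≡2 = subst Extremal (sym n≡2+k*7) (extremal (n div 7))
  where
  n≡2+k*7 : n ≡ 2 ℕ.+ n div 7 ℕ.* 7
  n≡2+k*7 = trans (m≡m%n+[m/n]*n n 7) (cong (ℕ._+ n div 7 ℕ.* 7) n%7≡2)
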